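{- Let $A$ be an alphabet of size $k$ with $k>1$, and suppose $L\subseteq A^*$ is $n$-PT. Then the canonical (minimal) DFA for $L$ has at most $m$ states, where $\log m = k\left(\frac{n+2k-3}{k-1}\right)^{k-1}\log n\,\log k$, with $\log$ denoting the logarithm to base $2$. Thus, for fixed $k$, the number of states of the canonical DFA of $L$ is in $2^{O(n^{k-1}\log n)}$ where $n=h(L)$.
   Context: For $n\in\mathbb{N}$, $u\sim_n v$ iff $u$ and $v$ have exactly the same (scattered) subwords of length at most $n$. A language $L\subseteq A^*$ is $n$-PT if it is a union of $\sim_n$-classes; $h(L)$ is the least $n$ such that $L$ is $n$-PT.
   Formalization: The explicit bound is stated for n > 1: for n = 0, log n is undefined, and for n = 1 it gives m = 1, although the 1-PT language of words containing a given letter needs two states. Membership in L is assumed decidable, which is automatic classically. -}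

module Defs where

open import Algebra.Definitions.RawSemiring using (_^_)
open import Data.Fin using (Fin)
open import Data.Fin.Subset using (Subset) renaming (_∈_ to _∈ₛ_)
open import Data.Integer using (∣_∣) renaming (+_ to pos)
open import Data.List using (List; length; foldl)
open import Data.List.Relation.Binary.Sublist.Propositional using () renaming (_⊆_ to _⊑_)
open import Data.Nat as ℕ using (ℕ; >-nonZero)
open import Data.Nat.Properties using (m<n⇒0<n∸m)
open import Data.Product using (_×_; ∃-syntax; Σ-syntax)
open import Data.Rational.Unnormalised as ℚ using (ℚᵘ; Positive; ↥_; ↧ₙ_; +-*-rawSemiring)
open import Function.Bundles using (_⇔_)
open import Level using (0ℓ)
open import Relation.Unary using (Pred; _⊆_; _≐_)

-- Words, Simon's congruence and piecewise testability

Language : Set → Set₁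
Language A = Pred (List A) 0ℓ

-- u ⊑ w is the sublist relation of the library: u is a scattered subword of w.
_∼[_]_ : {A : Set} → List A → ℕ → List A → Set
u ∼[ n ] v = ∀ w → length w ℕ.≤ n → (w ⊑ u) ⇔ (w ⊑ v)

-- L is the union of the ∼ₙ-classes of the words in some set S.
IsPT : {A : Set} → ℕ → Language A → Set₁
IsPT {A} n L = Σ[ S ∈ Language A ] L ≐ (λ w → ∃[ u ] (S u × u ∼[ n ] w))

-- h(L) = n
HasHeight : {A : Set} → Language A → ℕ → Set₁
HasHeight L n = IsPT n L × (∀ m → IsPT m L → n ℕ.≤ m)

-- Complete deterministic automata

record DFA (A : Set) : Set where
  field
    size  : ℕ
    start : Fin size
    step  : Fin size → A → Fin size
    final : Subset size

  accepted : Language A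
  accepted w = foldl step start w ∈ₛ final

open DFA public using (size; accepted)

Recognises : {A : Set} → DFA A → Language A → Set
Recognises D L = L ≐ accepted D

IsMinimalDFA : {A : Set} → DFA A → Language A → Set
IsMinimalDFA D L =
  Recognises D L × (∀ D′ → Recognises D′ L → size D ℕ.≤ size D′)

-- A nonnegative real x is represented by the set of rationals r with x < r.
-- All the elements of such a set are positive, and the set has no least
-- element.

Cut : Set₁
Cut = Pred ℚᵘ 0ℓ

infix  4 _≤ᶜ_
infixr 7 _·_
infixr 8 2^_

_≤ᶜ_ : Cut → Cut → Set
x ≤ᶜ y = y ⊆ x

-- For q ≥ 0 only.
fromℚ : ℚᵘ → Cut
fromℚ q r = q ℚ.< r

fromℕ : ℕ → Cut
fromℕ n = fromℚ (pos n ℚ./ 1)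

_·_ : Cut → Cut → Cut
(x · y) r = ∃[ a ] ∃[ b ] (x a × y b × a ℚ.* b ℚ.≤ r)

-- For n ≥ 1 and p, q > 0: log₂ n < p / q  iff  n ^ q < 2 ^ p.
log₂ : ℕ → Cut
log₂ n r = Positive r × n ℕ.^ (↧ₙ r) ℕ.< 2 ℕ.^ ∣ ↥ r ∣

_^ℚ_ : ℚᵘ → ℕ → ℚᵘ
_^ℚ_ = _^_ +-*-rawSemiring

-- 2 ^ x < r  iff  2 ^ (p / q) ≤ r, that is 2 ^ p ≤ r ^ q, for some p / q > x.
2^_ : Cut → Cut
(2^ x) r = Positive r × ∃[ a ] (x a × (pos 2 ℚ./ 1) ^ℚ ∣ ↥ a ∣ ℚ.≤ r ^ℚ (↧ₙ a))

-- k ((n + 2k - 3) / (k - 1)) ^ (k - 1); the subtractions are exact as k ≥ 2.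
coefficient : (k : ℕ) → k ℕ.> 1 → ℕ → ℚᵘ
coefficient k k>1 n = (pos k ℚ./ 1) ℚ.* (ratio ^ℚ (k ℕ.∸ 1))
  where
  ratio : ℚᵘ
  ratio = ℚ._/_ (pos (n ℕ.+ 2 ℕ.* k ℕ.∸ 3)) (k ℕ.∸ 1) {{>-nonZero (m<n⇒0<n∸m k>1)}}

module Submission where

-- Reading a word over k letters from right to left, close an arch as soon as
-- the letters read since the previous arch exhaust the alphabet. Such an arch is
-- a letter followed by a word over the k - 1 other letters, and what precedes
-- the last arch misses a letter too. If there are m < n arches, each of these
-- m + 1 words may be replaced by an equivalent one modulo ∼[ n ∸ m + 1 ] (the
-- prefix: modulo ∼[ n ∸ m ]), because every other arch absorbs one letter of a
-- subword; all words with n or more arches are equivalent. Hence the number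
-- C k n of ∼[ n ]-classes satisfies
--   C k n ≤ 1 + ∑_{m < n} (k C (k - 1) (n ∸ pred m)) ^ (m + 1),
-- and by the inequality of arithmetic and geometric means, induction on k gives
--   C k n ≤ (n k ^ (k - 1)) ^ g  with  g = ⌊((n + 2k - 3) / (k - 1)) ^ (k - 1)⌋.
-- Equivalent words lie in the same Nerode class, so this also bounds the number
-- of states.

open import Defs
open import Data.Bool using (true)
open import Data.Fin as Fin using (Fin; zero; suc; punchIn; punchOut)
open import Data.Fin.Properties as Fin
  using (punchIn-injective; punchInᵢ≢i; punchIn-punchOut; injective⇒≤)
open import Data.Integer as ℤ using (∣_∣; -[1+_]; +<+; +≤+) renaming (+_ to pos)
open import Data.Integer.Properties as ℤ using (pos-*)
open import Data.List
  using (List; []; _∷_; _++_; [_]; length; map; take; drop; replicate; concat;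
         concatMap; allFin; cartesianProduct; cartesianProductWith; lookup; foldl;
         deduplicate)
import Data.List.Membership.DecPropositional as DecMembership
open import Data.List.Membership.Propositional using (_∈_; _∉_)
open import Data.List.Membership.Propositional.Properties
  using (∈-allFin; ∈-map⁻; ∈-lookup)
open import Data.List.Properties
  using (length-++; length-map; length-take; length-drop; take++drop≡id; ++-assoc;
         ++-identityʳ; length-tabulate; foldl-++; length-deduplicate; map-∘; map-id;
         map-cong)
open import Data.List.Relation.Binary.Pointwise using (Pointwise; []; _∷_)
open import Data.List.Relation.Binary.Sublist.Propositional
  using ([]; _∷_; _∷ʳ_; from∈; minimum) renaming (_⊆_ to _⊑_; ⊆-trans to ⊑-trans)
open import Data.List.Relation.Binary.Sublist.Propositional.Properties
  using (++⁺; take-⊆; drop-⊆) renaming (map⁺ to ⊑-map⁺)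
open import Data.List.Relation.Unary.All as All using (All; []; _∷_)
open import Data.List.Relation.Unary.AllPairs using (AllPairs; []; _∷_)
open import Data.List.Relation.Unary.Any as Any using (Any; here; there)
import Data.List.Relation.Unary.Any.Properties as Any
import Data.List.Relation.Unary.Unique.DecSetoid.Properties as Unique
open import Data.Nat
  using (ℕ; zero; suc; pred; _+_; _*_; _^_; _∸_; _/_; _≤_; _<_; _>_; _≥_; z≤n;
         s≤s; _≤?_; _<?_; _≟_; NonZero; >-nonZero)
open import Data.Nat.DivMod using (m*n/n≡m; /-monoˡ-≤; m/n*n≤m)
open import Data.Nat.Properties hiding (_≤?_; _<?_; _≟_)
open import Data.Nat.Tactic.RingSolver using (solve-∀)
open import Data.Product using (_×_; _,_; ∃-syntax; ∃₂; proj₁; proj₂; map₂)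
open import Data.Rational.Unnormalised as ℚ using (ℚᵘ; mkℚᵘ; Positive; ↥_; ↧ₙ_; *≤*; *<*)
import Data.Rational.Unnormalised.Properties as ℚ
open import Data.Sum using (inj₁; inj₂)
import Data.Vec as Vec
open import Data.Vec.Properties using ([]=⇒lookup; lookup⇒[]=; lookup∘tabulate)
open import Function using (_∘_; id; _⇔_; mk⇔; Equivalence; Inverse)
open import Function.Bundles using (_↔_)
open import Level using (0ℓ)
open import Relation.Binary
  using (Rel; Symmetric; DecSetoid) renaming (Decidable to Decidable₂)
open import Relation.Binary.PropositionalEquality hiding ([_])
open import Relation.Nullary using (¬_; Dec; yes; no; contradiction; does; ¬?)
open import Relation.Nullary.Decidable using (_×-dec_; _→-dec_; map′; dec-true)
open import Relation.Unary using (Decidable)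

open Equivalence using (to; from)

private variable
  A B : Set
  k ℓ m n : ℕ

-- Simon's congruence and products with rich words.

infix 4 _≲[_]_

_≲[_]_ : List A → ℕ → List A → Set
u ≲[ n ] v = ∀ w → length w ≤ n → w ⊑ u → w ⊑ v

-- Only this consequence is needed of u being a product of ℓ words that each
-- contain every letter.
Rich : ℕ → List A → Set
Rich ℓ u = ∀ w → length w ≤ ℓ → w ⊑ u

∼-refl : {u : List A} → u ∼[ n ] u
∼-refl w _ = mk⇔ id id

∼-sym : {u v : List A} → u ∼[ n ] v → v ∼[ n ] u
∼-sym u∼v w w≤n = mk⇔ (from (u∼v w w≤n)) (to (u∼v w w≤n))

∼-trans : {u v w : List A} → u ∼[ n ] v → v ∼[ n ] w → u ∼[ n ] w
∼-trans u∼v v∼w x x≤n =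
  mk⇔ (to (v∼w x x≤n) ∘ to (u∼v x x≤n)) (from (u∼v x x≤n) ∘ from (v∼w x x≤n))

∼-mono : {u v : List A} → m ≤ n → u ∼[ n ] v → u ∼[ m ] v
∼-mono m≤n u∼v w w≤m = u∼v w (≤-trans w≤m m≤n)

∼⇒≲ : {u v : List A} → u ∼[ n ] v → u ≲[ n ] v
∼⇒≲ u∼v w w≤n = to (u∼v w w≤n)

≲-antisym : {u v : List A} → u ≲[ n ] v → v ≲[ n ] u → u ∼[ n ] v
≲-antisym u≲v v≲u w w≤n = mk⇔ (u≲v w w≤n) (v≲u w w≤n)

⊑-++⁻ : (u : List A) {v w : List A} → w ⊑ u ++ v →
        ∃₂ λ x y → w ≡ x ++ y × x ⊑ u × y ⊑ v
⊑-++⁻ []      w⊑v = [] , _ , refl , [] , w⊑v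
⊑-++⁻ (a ∷ u) (.a ∷ʳ w⊑) with ⊑-++⁻ u w⊑
... | x , y , w≡ , x⊑u , y⊑v = x , y , w≡ , a ∷ʳ x⊑u , y⊑v
⊑-++⁻ (a ∷ u) (refl ∷ w⊑) with ⊑-++⁻ u w⊑
... | x , y , refl , x⊑u , y⊑v = a ∷ x , y , refl , refl ∷ x⊑u , y⊑v

⊑-map⁻ : (f : A → B) (u : List A) {w : List B} → w ⊑ map f u →
         ∃[ x ] (w ≡ map f x × x ⊑ u)
⊑-map⁻ f []      []        = [] , refl , []
⊑-map⁻ f (a ∷ u) (_ ∷ʳ w⊑) with ⊑-map⁻ f u w⊑
... | x , w≡ , x⊑u = x , w≡ , a ∷ʳ x⊑u
⊑-map⁻ f (a ∷ u) (refl ∷ w⊑) with ⊑-map⁻ f u w⊑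
... | x , refl , x⊑u = a ∷ x , refl , refl ∷ x⊑u

-- A subword of an image is the image of a subword of the same length. The uses are `punchIn a`,
-- which embeds the alphabet without `a`, and the final change of alphabet.
∼-map : (f : A → B) {u v : List A} → u ∼[ n ] v → map f u ∼[ n ] map f v
∼-map {n = n} f u∼v = ≲-antisym (≲-map u∼v) (≲-map (∼-sym u∼v))
  where
  ≲-map : ∀ {u v} → u ∼[ n ] v → map f u ≲[ n ] map f v
  ≲-map {u} u∼v w w≤n w⊑ with ⊑-map⁻ f u w⊑
  ... | x , refl , x⊑u =
    ⊑-map⁺ f (to (u∼v x (subst (_≤ n) (length-map f x) w≤n)) x⊑u)

-- The part of a subword of u ++ v that does not fit into the last n letters
-- is moved to u, where the richness of u finds room for it.
≲-++ˡ : {u v v′ : List A} → Rich ℓ u → v ≲[ n ] v′ → u ++ v ≲[ ℓ + n ] u ++ v′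
≲-++ˡ {ℓ = ℓ} {n = n} {u = u} {v′ = v′} rich v≲v′ w w≤ w⊑ with ⊑-++⁻ u w⊑
... | x , y , refl , x⊑u , y⊑v with length y ≤? n
...   | yes y≤n = ++⁺ x⊑u (v≲v′ y y≤n y⊑v)
...   | no  y≰n = subst (_⊑ u ++ v′) x++y≡
          (++⁺ (rich (x ++ take d y) prefix≤)
               (v≲v′ (drop d y) suffix≤ (⊑-trans (drop-⊆ d y) y⊑v)))
  where
  d = length y ∸ n
  n≤y = <⇒≤ (≰⇒> y≰n)
  x++y≡ : (x ++ take d y) ++ drop d y ≡ x ++ y
  x++y≡ = trans (++-assoc x _ _) (cong (x ++_) (take++drop≡id d y))
  suffix≤ : length (drop d y) ≤ n
  suffix≤ = ≤-reflexive (trans (length-drop d y) (m∸[m∸n]≡n n≤y))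
  prefix≤ : length (x ++ take d y) ≤ ℓ
  prefix≤ = +-cancelʳ-≤ n _ _ (begin
    length (x ++ take d y) + n          ≡⟨ cong (_+ n) (length-++ x) ⟩
    length x + length (take d y) + n    ≤⟨ +-monoˡ-≤ n (+-monoʳ-≤ (length x) (≤-trans (≤-reflexive (length-take d y)) (m⊓n≤m d _))) ⟩
    length x + d + n                    ≡⟨ +-assoc (length x) d n ⟩
    length x + (d + n)                  ≡⟨ cong (length x +_) (m∸n+n≡m n≤y) ⟩
    length x + length y                 ≡⟨ length-++ x ⟨
    length (x ++ y)                     ≤⟨ w≤ ⟩
    ℓ + n                               ∎)
    where open ≤-Reasoning

-- Mirror image of `≲-++ˡ`: whatever of `x` exceeds its first `n` letters is pushed to the right
-- into `u`.
≲-++ʳ : {u v v′ : List A} → Rich ℓ u → v ≲[ n ] v′ → v ++ u ≲[ ℓ + n ] v′ ++ u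
≲-++ʳ {ℓ = ℓ} {n = n} {u = u} {v = v} {v′ = v′} rich v≲v′ w w≤ w⊑ with ⊑-++⁻ v w⊑
... | x , y , refl , x⊑v , y⊑u with length x ≤? n
...   | yes x≤n = ++⁺ (v≲v′ x x≤n x⊑v) y⊑u
...   | no  x≰n = subst (_⊑ v′ ++ u) x++y≡
          (++⁺ (v≲v′ (take n x) prefix≤ (⊑-trans (take-⊆ n x) x⊑v))
               (rich (drop n x ++ y) suffix≤))
  where
  n≤x = <⇒≤ (≰⇒> x≰n)
  x++y≡ : take n x ++ drop n x ++ y ≡ x ++ y
  x++y≡ = trans (sym (++-assoc (take n x) _ _)) (cong (_++ y) (take++drop≡id n x))
  prefix≤ : length (take n x) ≤ n
  prefix≤ = ≤-trans (≤-reflexive (length-take n x)) (m⊓n≤m n _)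
  suffix≤ : length (drop n x ++ y) ≤ ℓ
  suffix≤ = +-cancelʳ-≤ n _ _ (begin
    length (drop n x ++ y) + n          ≡⟨ cong (_+ n) (length-++ (drop n x)) ⟩
    length (drop n x) + length y + n    ≡⟨ cong (λ i → i + length y + n) (length-drop n x) ⟩
    length x ∸ n + length y + n         ≡⟨ +-comm _ n ⟩
    n + (length x ∸ n + length y)       ≡⟨ +-assoc n _ _ ⟨
    n + (length x ∸ n) + length y       ≡⟨ cong (_+ length y) (m+[n∸m]≡n n≤x) ⟩
    length x + length y                 ≡⟨ length-++ x ⟨
    length (x ++ y)                     ≤⟨ w≤ ⟩
    ℓ + n                               ∎)
    where open ≤-Reasoning

∼-++ˡ : {u v v′ : List A} → Rich ℓ u → v ∼[ n ] v′ → (u ++ v) ∼[ ℓ + n ] (u ++ v′)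
∼-++ˡ rich v∼v′ = ≲-antisym (≲-++ˡ rich (∼⇒≲ v∼v′)) (≲-++ˡ rich (∼⇒≲ (∼-sym v∼v′)))

∼-++ʳ : {u v v′ : List A} → Rich ℓ u → v ∼[ n ] v′ → (v ++ u) ∼[ ℓ + n ] (v′ ++ u)
∼-++ʳ rich v∼v′ = ≲-antisym (≲-++ʳ rich (∼⇒≲ v∼v′)) (≲-++ʳ rich (∼⇒≲ (∼-sym v∼v′)))

rich-zero : (u : List A) → Rich 0 u
rich-zero u [] _ = minimum u

rich-one : {u : List A} → (∀ a → a ∈ u) → Rich 1 u
rich-one all []          _         = minimum _
rich-one all (a ∷ [])    _         = from∈ (all a)
rich-one all (_ ∷ _ ∷ _) (s≤s ())

rich-++ : {u v : List A} → Rich ℓ u → Rich m v → Rich (ℓ + m) (u ++ v)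
rich-++ {ℓ = ℓ} {m = m} {u = u} {v = v} richᵘ richᵛ w w≤ =
  subst (_⊑ u ++ v) (take++drop≡id ℓ w) (++⁺
    (richᵘ (take ℓ w) (≤-trans (≤-reflexive (length-take ℓ w)) (m⊓n≤m ℓ _)))
    (richᵛ (drop ℓ w) (≤-trans (≤-reflexive (length-drop ℓ w)) (m≤n+o⇒m∸n≤o _ ℓ w≤))))

rich-∼ : {u v : List A} → Rich n u → u ∼[ n ] v → Rich n v
rich-∼ rich u∼v w w≤n = to (u∼v w w≤n) (rich w w≤n)

-- Arch factorisation from the right.

-- A block (a , u) stands for the word u over the alphabet without a, which is
-- identified with Fin k through punchIn a.

Block : ℕ → Set
Block k = Fin (suc k) × List (Fin k)

poor : Block k → List (Fin (suc k))
poor (a , u) = map (punchIn a) u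

arch : Block k → List (Fin (suc k))
arch b = proj₁ b ∷ poor b

arches : List (Block k) → List (Fin (suc k))
arches = concatMap arch

RichBlock : Block k → Set
RichBlock (a , u) = Rich 1 u

rich-arch : (b : Block k) → RichBlock b → Rich 1 (arch b)
rich-arch (a , u) rich []          _        = minimum _
rich-arch (a , u) rich (_ ∷ _ ∷ _) (s≤s ())
rich-arch (a , u) rich (b ∷ [])    _        with a Fin.≟ b
... | yes a≡b = sym a≡b ∷ minimum _
... | no  a≢b = a ∷ʳ subst (λ c → [ c ] ⊑ map (punchIn a) u) (punchIn-punchOut a≢b)
                       (⊑-map⁺ (punchIn a) (rich [ punchOut a≢b ] ≤-refl))

rich-arches : {bs : List (Block k)} → All RichBlock bs → Rich (length bs) (arches bs)
rich-arches []                    = rich-zero []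
rich-arches {bs = b ∷ _} (r ∷ rs) = rich-++ (rich-arch b r) (rich-arches rs)

missing⇒poor : (a : Fin (suc k)) (w : List (Fin (suc k))) → a ∉ w →
               ∃[ u ] w ≡ poor (a , u)
missing⇒poor a []      a∉w = [] , refl
missing⇒poor a (b ∷ w) a∉w with missing⇒poor a w (a∉w ∘ there)
... | u , refl = punchOut (a∉w ∘ here) ∷ u , cong (_∷ _) (sym (punchIn-punchOut _))

-- Induction keeps an open prefix that misses at least one letter. A new letter `x` either leaves
-- some letter missing, and the prefix stays open, or completes the alphabet and closes an arch.
factorise : (w : List (Fin (suc k))) →
            ∃₂ λ b bs → w ≡ poor b ++ arches bs × All RichBlock bs
factorise []      = (zero , []) , [] , refl , []
factorise {k} (x ∷ w) with factorise w
... | b@(a , u) , bs , w≡ , rich with Fin.any? (λ c → ¬? (c ∈? (x ∷ poor b)))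
  where open DecMembership (Fin._≟_ {suc k}) using (_∈?_)
-- The missing letter `c` may differ from `a`, so the prefix is encoded anew relative to `c`.
...   | yes (c , c∉) with missing⇒poor c (x ∷ poor b) c∉
...     | v , xb≡ = (c , v) , bs , trans (cong (x ∷_) w≡) (cong (_++ arches bs) xb≡) , rich
factorise {k} (x ∷ w) | b@(a , u) , bs , w≡ , rich | no full =
  -- Since `a` does not occur in `poor b`, the completing letter `x` is `a` itself, and the closed
  -- arch is exactly `arch b`. The new prefix is empty, so any letter can serve as its label; `a` is
  -- chosen.
  (a , []) , b ∷ bs , trans (cong (x ∷_) w≡) (cong (λ c → c ∷ poor b ++ arches bs) x≡a) ,
  rich-one all∈u ∷ rich
  where
  open DecMembership (Fin._≟_ {suc k}) using (_∈?_)
  present : ∀ c → c ∈ x ∷ poor b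
  present c with c ∈? (x ∷ poor b)
  ... | yes c∈ = c∈
  ... | no  c∉ = contradiction (c , c∉) full
  a∉poor : a ∉ poor b
  a∉poor a∈ with ∈-map⁻ (punchIn a) a∈
  ... | c , _ , a≡ = punchInᵢ≢i a c (sym a≡)
  x≡a : x ≡ a
  x≡a with present a
  ... | here a≡x   = sym a≡x
  ... | there a∈   = contradiction a∈ a∉poor
  all∈u : ∀ c → c ∈ u
  all∈u c with present (punchIn a c)
  ... | here p≡x  = contradiction (trans p≡x x≡a) (punchInᵢ≢i a c)
  ... | there c∈ with ∈-map⁻ (punchIn a) c∈
  ...   | d , d∈u , eq = subst (_∈ u) (sym (punchIn-injective a c d eq)) d∈u

BlockEq : ℕ → Block k → Block k → Set
BlockEq n (a , u) (b , v) = a ≡ b × u ∼[ n ] v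

∼-poor : {b c : Block k} → BlockEq n b c → poor b ∼[ n ] poor c
∼-poor {b = a , _} (refl , u∼v) = ∼-map (punchIn a) u∼v

∼-arch : {b c : Block k} → BlockEq n b c → arch b ∼[ n ] arch c
∼-arch b∼c@(refl , _) = ∼-++ˡ (rich-zero [ _ ]) (∼-poor b∼c)

-- The head arch is replaced first, then the tail by induction. Each arch that stays in place
-- absorbs one letter of a subword. The level `suc n` is at least 1, so the new head is rich again
-- and can absorb a letter while the tail is replaced.
∼-arches : {bs cs : List (Block k)} → All RichBlock bs →
           Pointwise (BlockEq (suc n)) bs cs → arches bs ∼[ length bs + n ] arches cs
∼-arches []       []         = ∼-refl
∼-arches {n = n} {bs = b ∷ bs} {cs = c ∷ _} (r ∷ rs) (b∼c@(_ , u∼v) ∷ bs∼cs) = ∼-trans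
  (subst (λ i → (arch b ++ arches bs) ∼[ i ] (arch c ++ arches bs)) (+-suc (length bs) n)
    (∼-++ʳ (rich-arches rs) (∼-arch b∼c)))
  (∼-++ˡ (rich-arch c (rich-∼ r (∼-mono (s≤s z≤n) u∼v))) (∼-arches rs bs∼cs))

-- Representatives of the congruence classes.

tuples : ℕ → List A → List (List A)
tuples zero    xs = [] ∷ []
tuples (suc m) xs = cartesianProductWith _∷_ xs (tuples m xs)

tuples⁺ : {R : A → A → Set} {xs : List A} → (∀ y → Any (R y) xs) → ∀ ys →
          Any (Pointwise R ys) (tuples (length ys) xs)
tuples⁺ cover []       = here []
tuples⁺ cover (y ∷ ys) = Any.cartesianProductWith⁺ _∷_ _∷_ (cover y) (tuples⁺ cover ys)

length-cartesianProductWith : {C : Set} (f : A → B → C) (xs : List A) (ys : List B) →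
  length (cartesianProductWith f xs ys) ≡ length xs * length ys
length-cartesianProductWith f []       ys = refl
length-cartesianProductWith f (x ∷ xs) ys =
  trans (length-++ (map (f x) ys))
        (cong₂ _+_ (length-map (f x) ys) (length-cartesianProductWith f xs ys))

length-tuples : ∀ m (xs : List A) → length (tuples m xs) ≡ length xs ^ m
length-tuples zero    xs = refl
length-tuples (suc m) xs = trans (length-cartesianProductWith _∷_ xs (tuples m xs))
                                 (cong (length xs *_) (length-tuples m xs))

blocks : List (List (Fin k)) → List (Block k)
blocks {k} = cartesianProduct (allFin (suc k))

-- Undoes `factorise`: the first block is the open prefix, the others are arches. The clause for
-- `[]` is a filler, as `layer` glues only tuples of length `suc m`.
glue : List (Block k) → List (Fin (suc k))
glue []       = []
glue (b ∷ bs) = poor b ++ arches bs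

-- A word with m < n arches has its blocks replaced by representatives modulo
-- ∼[ n ∸ m + 1 ], or modulo ∼[ n ] if m = 0: both are n ∸ pred m.
layer : (ℕ → List (List (Fin k))) → ℕ → ℕ → List (List (Fin (suc k)))
layer R n m = map glue (tuples (suc m) (blocks (R (n ∸ pred m))))

-- Represents the one class that contains all words with `n` or more arches.
universal : ∀ k → ℕ → List (Fin k)
universal k n = concat (replicate n (allFin k))

layers : (ℕ → List (List (Fin k))) → ℕ → ℕ → List (List (Fin (suc k)))
layers R n zero    = universal _ n ∷ []
layers R n (suc m) = layer R n m ++ layers R n m

reps : ∀ k → ℕ → List (List (Fin k))
reps zero    n = [] ∷ []
reps (suc k) n = layers (reps k) n n

rich-universal : ∀ n → Rich n (universal k n)
rich-universal zero    = rich-zero []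
rich-universal (suc n) = rich-++ (rich-one ∈-allFin) (rich-universal n)

∈-layers : {P : List (Fin (suc k)) → Set} {R : ℕ → List (List (Fin k))} →
           ∀ j → m < j → Any P (layer R n m) → Any P (layers R n j)
∈-layers {m = m} {n = n} {R = R} (suc j) m<1+j p with m ≟ j
... | yes refl = Any.++⁺ˡ p
... | no  m≢j  = Any.++⁺ʳ (layer R n j) (∈-layers j (≤∧≢⇒< (≤-pred m<1+j) m≢j) p)

∈-universal : {P : List (Fin (suc k)) → Set} {R : ℕ → List (List (Fin k))} →
              ∀ j → P (universal (suc k) n) → Any P (layers R n j)
∈-universal zero    p = here p
∈-universal {n = n} {R = R} (suc j) p = Any.++⁺ʳ (layer R n j) (∈-universal j p)

-- With m > 0 arches the common level is n - m + 1. The prefix needs only n - m, because the m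
-- arches after it absorb m letters. The arches need the extra 1, because only m - 1 other arches
-- surround each of them.
glue-∼ : (bs : List (Block k)) {b : Block k} → length bs < n → All RichBlock bs →
         {cs : List (Block k)} →
         Pointwise (BlockEq (n ∸ pred (length bs))) (b ∷ bs) cs →
         (poor b ++ arches bs) ∼[ n ] glue cs
glue-∼ [] _ _ (b∼c ∷ []) = ∼-++ʳ (rich-zero []) (∼-poor b∼c)
glue-∼ {n = n} bs@(_ ∷ bs′) {b} m<n rich {c ∷ cs} (b∼c ∷ bs∼cs) =
  subst (λ i → (poor b ++ arches bs) ∼[ i ] (poor c ++ arches cs)) m+d≡n
    (∼-trans
      (∼-++ʳ (rich-arches rich) (∼-mono (n≤1+n d) (∼-poor (subst (λ i → BlockEq i b c) 1+d≡ b∼c))))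
      (∼-++ˡ (rich-zero (poor c)) (∼-arches rich (subst (λ i → Pointwise (BlockEq i) bs cs) 1+d≡ bs∼cs))))
  where
  d = n ∸ length bs
  m+d≡n : length bs + d ≡ n
  m+d≡n = m+[n∸m]≡n (<⇒≤ m<n)
  1+d≡ : n ∸ length bs′ ≡ suc d
  1+d≡ = +-∸-assoc 1 (<⇒≤ m<n)

reps-cover : ∀ k n (u : List (Fin k)) → Any (u ∼[ n ]_) (reps k n)
reps-cover zero    n []       = here ∼-refl
reps-cover zero    n (() ∷ _)
reps-cover (suc k) n u with factorise u
... | b , bs , refl , rich with length bs <? n
...   | yes m<n = ∈-layers n m<n (Any.map⁺ (Any.map (glue-∼ bs m<n rich)
          (tuples⁺ cover (b ∷ bs))))
  where
  cover : ∀ c → Any (BlockEq _ c) (blocks (reps k (n ∸ pred (length bs))))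
  cover (a , v) = Any.cartesianProduct⁺ (∈-allFin a) (reps-cover k _ v)
-- Both words contain every word of length at most `n`.
...   | no  m≮n = ∈-universal n (λ w w≤n → mk⇔
          (λ _ → rich-universal n w w≤n)
          (λ _ → rich-++ (rich-zero (poor b)) (rich-arches rich) w (≤-trans w≤n (≮⇒≥ m≮n))))

length-layer : (R : ℕ → List (List (Fin k))) → ∀ n m →
               length (layer R n m) ≡ (suc k * length (R (n ∸ pred m))) ^ suc m
length-layer {k} R n m = trans (length-map glue (tuples (suc m) bs)) (trans (length-tuples (suc m) bs)
  (cong (_^ suc m) (trans (length-cartesianProductWith _,_ (allFin (suc k)) (R (n ∸ pred m)))
     (cong (_* length (R (n ∸ pred m))) (length-tabulate {n = suc k} id)))))
  where bs = blocks (R (n ∸ pred m))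

-- The minimal automaton on Nerode classes.

AllPairs-lookup-injective : {R : Rel A 0ℓ} → Symmetric R → {xs : List A} →
  AllPairs (λ x y → ¬ R x y) xs → ∀ i j → R (lookup xs i) (lookup xs j) → i ≡ j
AllPairs-lookup-injective sym (x∉ ∷ _)  zero    zero    _ = refl
AllPairs-lookup-injective sym (x∉ ∷ _)  zero    (suc j) r = contradiction r (All.lookup x∉ (∈-lookup j))
AllPairs-lookup-injective sym (x∉ ∷ _)  (suc i) zero    r = contradiction (sym r) (All.lookup x∉ (∈-lookup i))
AllPairs-lookup-injective sym (_ ∷ xs!) (suc i) (suc j) r = cong suc (AllPairs-lookup-injective sym xs! i j r)

does⁻ : {P : Set} (P? : Dec P) → does P? ≡ true → P
does⁻ (yes p) _ = p

module Nerode {A : Set} (L : Language A) (L? : Decidable L) {n : ℕ} (pt : IsPT n L)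
              (rs : List (List A)) (cover : ∀ u → Any (u ∼[ n ]_) rs) where

  L-∼ : ∀ {u v} → u ∼[ n ] v → L u → L v
  L-∼ u∼v Lu with proj₁ (proj₂ pt) Lu
  ... | t , St , t∼u = proj₂ (proj₂ pt) (t , St , ∼-trans t∼u u∼v)

  infix 4 _≈_ _≈?_

  _≈_ : Rel (List A) 0ℓ
  u ≈ v = ∀ w → L (u ++ w) ⇔ L (v ++ w)

  ≈-refl : ∀ {u} → u ≈ u
  ≈-refl w = mk⇔ id id

  ≈-sym : ∀ {u v} → u ≈ v → v ≈ u
  ≈-sym u≈v w = mk⇔ (from (u≈v w)) (to (u≈v w))

  ≈-trans : ∀ {u v w} → u ≈ v → v ≈ w → u ≈ w
  ≈-trans u≈v v≈w x = mk⇔ (to (v≈w x) ∘ to (u≈v x)) (from (u≈v x) ∘ from (v≈w x))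

  ≈-++ : ∀ {u v} w → u ≈ v → u ++ w ≈ v ++ w
  ≈-++ {u} {v} w u≈v x rewrite ++-assoc u w x | ++-assoc v w x = u≈v (w ++ x)

  ∼⇒≈ : ∀ {u v} → u ∼[ n ] v → u ≈ v
  ∼⇒≈ u∼v w = mk⇔ (L-∼ uw∼vw) (L-∼ (∼-sym uw∼vw))
    where uw∼vw = ∼-++ʳ (rich-zero w) u∼v

  -- A suffix may be exchanged for its representative in `rs`, since `∼[ n ]` is a congruence that
  -- saturates `L`. Testing the finitely many suffixes in `rs` therefore suffices.
  _≈?_ : Decidable₂ _≈_
  u ≈? v = map′ extend (λ u≈v → All.universal (λ w → to (u≈v w) , from (u≈v w)) rs)
    (All.all? (λ w → (L? (u ++ w) →-dec L? (v ++ w)) ×-dec (L? (v ++ w) →-dec L? (u ++ w))) rs)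
    where
    extend : All (λ w → (L (u ++ w) → L (v ++ w)) × (L (v ++ w) → L (u ++ w))) rs → u ≈ v
    extend agree w with All.lookupAny agree (cover w)
    ... | (u⇒v , v⇒u) , w∼r = mk⇔
      (L-∼ (∼-sym (right v)) ∘ u⇒v ∘ L-∼ (right u))
      (L-∼ (∼-sym (right u)) ∘ v⇒u ∘ L-∼ (right v))
      where
      right : ∀ x → (x ++ w) ∼[ n ] (x ++ Any.lookup (cover w))
      right x = ∼-++ˡ (rich-zero x) w∼r

  Nerode : DecSetoid 0ℓ 0ℓ
  Nerode = record
    { _≈_ = _≈_
    ; isDecEquivalence = record
      { isEquivalence = record { refl = ≈-refl ; sym = ≈-sym ; trans = ≈-trans }
      ; _≟_ = _≈?_ } }

  states : List (List A)
  states = deduplicate _≈?_ rs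

  state∃ : ∀ u → Any (u ≈_) states
  state∃ u = Any.deduplicate⁺ _≈?_ (λ y≈x u≈x → ≈-trans u≈x (≈-sym y≈x)) (Any.map ∼⇒≈ (cover u))

  state : List A → Fin (length states)
  state u = Any.index (state∃ u)

  word : Fin (length states) → List A
  word = lookup states

  word-state : ∀ u → u ≈ word (state u)
  word-state u = Any.lookup-index (state∃ u)

  word-injective : ∀ i j → word i ≈ word j → i ≡ j
  word-injective = AllPairs-lookup-injective ≈-sym (Unique.deduplicate-! Nerode rs)

  automaton : DFA A
  automaton = record
    { size  = length states
    ; start = state []
    ; step  = λ i a → state (word i ++ [ a ])
    ; final = Vec.tabulate (does ∘ L? ∘ word)
    }

  open DFA

  -- Each transition replaces the word read by an equivalent representative; right invariance of `≈`
  -- keeps the replacement harmless for the rest of the input.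
  run : ∀ i w → word i ++ w ≈ word (foldl (step automaton) i w)
  run i []      x = subst (λ u → L (u ++ x) ⇔ L (word i ++ x)) (sym (++-identityʳ (word i))) (≈-refl {word i} x)
  run i (a ∷ w) = ≈-trans
    (subst (_≈ word (step automaton i a) ++ w) (++-assoc (word i) [ a ] w)
      (≈-++ w (word-state (word i ++ [ a ]))))
    (run (step automaton i a) w)

  recognises : Recognises automaton L
  recognises = L⊆ , ⊆L
    where
    end = foldl (step automaton) (start automaton)
    end≈ : ∀ w → w ≈ word (end w)
    end≈ w = ≈-trans (≈-++ w (word-state [])) (run (state []) w)
    L-≈ : ∀ {u v} → u ≈ v → L u → L v
    L-≈ {u} {v} u≈v Lu = subst L (++-identityʳ v) (to (u≈v []) (subst L (sym (++-identityʳ u)) Lu))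
    L⊆ : ∀ {w} → L w → accepted automaton w
    L⊆ {w} Lw = lookup⇒[]= (end w) _ (trans (lookup∘tabulate _ (end w))
      (dec-true (L? (word (end w))) (L-≈ (end≈ w) Lw)))
    ⊆L : ∀ {w} → accepted automaton w → L w
    ⊆L {w} acc = L-≈ (≈-sym (end≈ w)) (does⁻ (L? (word (end w)))
      (trans (sym (lookup∘tabulate _ (end w))) ([]=⇒lookup acc)))

  -- Words that lead to the same state of `D` are Nerode equivalent, so the pairwise inequivalent
  -- words of `states` reach distinct states.
  minimal : ∀ D → Recognises D L → length states ≤ size D
  minimal D (L⊆ , ⊆L) = injective⇒≤ {f = reach ∘ word} (λ {i} {j} eq →
    word-injective i j (λ w → mk⇔ (transfer {word i} {word j} eq w) (transfer {word j} {word i} (sym eq) w)))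
    where
    reach = foldl (step D) (start D)
    transfer : ∀ {u v} → reach u ≡ reach v → ∀ w → L (u ++ w) → L (v ++ w)
    transfer {u} {v} eq w Luw = ⊆L (subst (λ q → final D Vec.[ q ]= true)
      (trans (foldl-++ (step D) (start D) u w)
        (trans (cong (λ q → foldl (step D) q w) eq) (sym (foldl-++ (step D) (start D) v w))))
      (L⊆ Luw))

-- Representatives over `Fin k` are decoded to `A` and still meet every class; removing Nerode
-- duplicates can only shorten their list.
minimalDFA : A ↔ Fin k → (L : Language A) → Decidable L → IsPT n L →
             ∃[ D ] (IsMinimalDFA D L × size D ≤ length (reps k n))
minimalDFA {A = A} {k = k} {n = n} A↔Fin L L? pt =
  automaton , (recognises , minimal) ,
  ≤-trans (length-deduplicate _≈?_ rs) (≤-reflexive (length-map _ (reps k n)))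
  where
  open Inverse A↔Fin using (strictlyInverseʳ) renaming (to to code; from to decode)
  rs = map (map decode) (reps k n)
  decode-code : (u : List A) → map decode (map code u) ≡ u
  decode-code u = trans (sym (map-∘ u)) (trans (map-cong strictlyInverseʳ u) (map-id u))
  cover : ∀ u → Any (u ∼[ n ]_) rs
  cover u = Any.map⁺ (Any.map
    (λ {r} u∼r → subst (_∼[ n ] map decode r) (decode-code u) (∼-map decode u∼r))
    (reps-cover k n (map code u)))
  open Nerode L L? pt rs cover

-- Inequality of means and the exponents of the bound.

^-distribʳ-* : ∀ a b n → (a * b) ^ n ≡ a ^ n * b ^ n
^-distribʳ-* a b zero    = refl
^-distribʳ-* a b (suc n) = trans (cong (a * b *_) (^-distribʳ-* a b n)) (rearrange a b (a ^ n) (b ^ n))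
  where
  rearrange : ∀ a b x y → a * b * (x * y) ≡ a * x * (b * y)
  rearrange = solve-∀

-- The right side exceeds the left by (b - a)(d - c).
rearrangement : ∀ {a b c d} → a ≤ b → c ≤ d → a * d + b * c ≤ a * c + b * d
rearrangement {a} {b} {c} {d} a≤b c≤d
  with x , refl ← m≤n⇒∃[o]m+o≡n a≤b | y , refl ← m≤n⇒∃[o]m+o≡n c≤d =
  ≤-trans (m≤m+n _ (x * y)) (≤-reflexive (expand a x c y))
  where
  expand : ∀ a x c y → a * (c + y) + (a + x) * c + x * y ≡ a * c + (a + x) * (c + y)
  expand = solve-∀

power-rearrangement : ∀ a b n → a * b ^ n + b * a ^ n ≤ a * a ^ n + b * b ^ n
power-rearrangement a b n with ≤-total a b
... | inj₁ a≤b = rearrangement a≤b (^-monoˡ-≤ n a≤b)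
... | inj₂ b≤a = subst₂ _≤_ (+-comm (b * a ^ n) _) (+-comm (b * b ^ n) _)
                   (rearrangement b≤a (^-monoˡ-≤ n b≤a))

-- The power x ^ (n + 1) lies above its tangent at `b`, here evaluated at `a` and written without
-- subtraction. The induction multiplies by `b` and repairs the result with `power-rearrangement`.
tangent : ∀ a b n → suc n * (a * b ^ n) ≤ a ^ suc n + n * b ^ suc n
tangent a b zero    = ≤-reflexive (base a)
  where
  base : ∀ a → 1 * (a * 1) ≡ a * 1 + 0
  base = solve-∀
tangent a b (suc n) = begin
  suc (suc n) * (a * (b * q))            ≡⟨ split a b q n ⟩
  b * (suc n * (a * q)) + a * (b * q)    ≤⟨ +-monoˡ-≤ _ (*-monoʳ-≤ b (tangent a b n)) ⟩
  b * (a * p + n * (b * q)) + a * (b * q) ≡⟨ regroup a b p q n ⟩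
  n * (b * (b * q)) + (a * (b * q) + b * (a * p)) ≤⟨ +-monoʳ-≤ (n * (b * (b * q))) (power-rearrangement a b (suc n)) ⟩
  n * (b * (b * q)) + (a * (a * p) + b * (b * q)) ≡⟨ collect a b p q n ⟩
  a * (a * p) + suc n * (b * (b * q))    ∎
  where
  open ≤-Reasoning
  p = a ^ n
  q = b ^ n
  split : ∀ a b q n → suc (suc n) * (a * (b * q)) ≡ b * (suc n * (a * q)) + a * (b * q)
  split = solve-∀
  regroup : ∀ a b p q n → b * (a * p + n * (b * q)) + a * (b * q) ≡ n * (b * (b * q)) + (a * (b * q) + b * (a * p))
  regroup = solve-∀
  collect : ∀ a b p q n → n * (b * (b * q)) + (a * (a * p) + b * (b * q)) ≡ a * (a * p) + suc n * (b * (b * q))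
  collect = solve-∀

-- The inequality between the means of a and n copies of b / n, obtained from
-- the tangent of x ↦ x ^ (n + 1) at (n + 1) b, evaluated at n (a + b).
weighted-AM-GM : ∀ a b n .{{_ : NonZero n}} →
  a * b ^ n * suc n ^ suc n ≤ n ^ n * (a + b) ^ suc n
weighted-AM-GM a b n = *-cancelˡ-≤ n (begin
  n * (a * b ^ n * (suc n * suc n ^ n))   ≡⟨ to-tangent a n (b ^ n) (suc n ^ n) ⟩
  n * suc n * a * (suc n ^ n * b ^ n)     ≡⟨ cong (n * suc n * a *_) (^-distribʳ-* (suc n) b n) ⟨
  n * suc n * a * T ^ n                   ≤⟨ +-cancelʳ-≤ (n * T ^ suc n) _ _ at-B ⟩
  S ^ suc n                               ≡⟨ ^-distribʳ-* n (a + b) (suc n) ⟩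
  n * n ^ n * (a + b) ^ suc n             ≡⟨ *-assoc n (n ^ n) _ ⟩
  n * (n ^ n * (a + b) ^ suc n)           ∎)
  where
  open ≤-Reasoning
  T = suc n * b
  S = n * (a + b)
  to-tangent : ∀ a n x y → n * (a * x * (suc n * y)) ≡ n * suc n * a * (y * x)
  to-tangent = solve-∀
  collect : ∀ a b n q → n * suc n * a * q + n * (suc n * b * q) ≡ suc n * (n * (a + b) * q)
  collect = solve-∀
  at-B : n * suc n * a * T ^ n + n * T ^ suc n ≤ S ^ suc n + n * T ^ suc n
  at-B = begin
    n * suc n * a * T ^ n + n * (suc n * b * T ^ n) ≡⟨ collect a b n (T ^ n) ⟩
    suc n * (S * T ^ n)                             ≤⟨ tangent S T n ⟩
    S ^ suc n + n * T ^ suc n                       ∎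

-- With k = i + 2, this is the integer part of ((n + 2k - 3) / (k - 1)) ^ (k - 1).
exponent : ℕ → ℕ → ℕ
exponent i n = _/_ ((1 + n + 2 * i) ^ suc i) (suc i ^ suc i) {{m^n≢0 (suc i) (suc i)}}

≤-exponent : ∀ i n {x} → x * suc i ^ suc i ≤ (1 + n + 2 * i) ^ suc i → x ≤ exponent i n
≤-exponent i n {x} x*d≤ = subst (_≤ exponent i n) (m*n/n≡m x d) (/-monoˡ-≤ d x*d≤)
  where
  d = suc i ^ suc i
  instance _ = m^n≢0 (suc i) (suc i)

exponent-≤ : ∀ i n → exponent i n * suc i ^ suc i ≤ (1 + n + 2 * i) ^ suc i
exponent-≤ i n = m/n*n≤m _ (suc i ^ suc i) {{m^n≢0 (suc i) (suc i)}}

-- The base of the power is at least 2. In `length-reps` this lets κ ^ x, with x the exponent, pay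
-- for a factor 2 κ per block.
exponent≥2 : ∀ i n → 2 ≤ n → 2 ≤ exponent i n
exponent≥2 i n 2≤n = ≤-exponent i n (begin
  2 * suc i ^ suc i         ≤⟨ *-monoˡ-≤ (suc i ^ suc i) (^-monoʳ-≤ 2 {1} {suc i} (s≤s z≤n)) ⟩
  2 ^ suc i * suc i ^ suc i ≡⟨ ^-distribʳ-* 2 (suc i) (suc i) ⟨
  (2 * suc i) ^ suc i       ≤⟨ ^-monoˡ-≤ (suc i) base ⟩
  (1 + n + 2 * i) ^ suc i   ∎)
  where
  open ≤-Reasoning
  base : 2 * suc i ≤ 1 + n + 2 * i
  base = begin
    2 * suc i     ≡⟨ *-suc 2 i ⟩
    2 + 2 * i     ≤⟨ +-monoˡ-≤ (2 * i) (m≤n⇒m≤1+n 2≤n) ⟩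
    1 + n + 2 * i ∎

-- This is where the shape of the exponent comes from: `weighted-AM-GM` is applied to `suc m` and
-- the numerator `b` of the smaller exponent, whose sum has a bound independent of `m`.
exponent-suc : ∀ i n m → m ≤ n → suc m * exponent i (n ∸ pred m) ≤ exponent (suc i) n
exponent-suc i n m m≤n = ≤-exponent (suc i) n (*-cancelˡ-≤ (j ^ j) {{m^n≢0 j j}} (begin
  j ^ j * (suc m * x * suc j ^ suc j)    ≡⟨ regroup (j ^ j) (suc m) x (suc j ^ suc j) ⟩
  suc m * (x * j ^ j) * suc j ^ suc j    ≤⟨ *-monoˡ-≤ (suc j ^ suc j) (*-monoʳ-≤ (suc m) (exponent-≤ i n′)) ⟩
  suc m * b ^ j * suc j ^ suc j          ≤⟨ weighted-AM-GM (suc m) b j ⟩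
  j ^ j * (suc m + b) ^ suc j            ≤⟨ *-monoʳ-≤ (j ^ j) (^-monoˡ-≤ (suc j) sum≤) ⟩
  j ^ j * (1 + n + 2 * j) ^ suc j        ∎))
  where
  open ≤-Reasoning
  j  = suc i
  n′ = n ∸ pred m
  x  = exponent i n′
  b  = 1 + n′ + 2 * i
  regroup : ∀ d a x e → d * (a * x * e) ≡ a * (x * d) * e
  regroup = solve-∀
  -- An equality for positive `m`; for `m = 0` one is lost, as `pred 0` is `0`.
  m+n′≤1+n : ∀ m → m ≤ n → m + (n ∸ pred m) ≤ suc n
  m+n′≤1+n zero    _   = n≤1+n n
  m+n′≤1+n (suc m) m<n = s≤s (≤-reflexive (m+[n∸m]≡n (<⇒≤ m<n)))
  left : ∀ m n′ i → suc m + (1 + n′ + 2 * i) ≡ m + n′ + (2 + 2 * i)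
  left = solve-∀
  right : ∀ n i → suc n + (2 + 2 * i) ≡ 1 + n + 2 * suc i
  right = solve-∀
  sum≤ : suc m + b ≤ 1 + n + 2 * j
  sum≤ = begin
    suc m + b               ≡⟨ left m n′ i ⟩
    m + n′ + (2 + 2 * i)    ≤⟨ +-monoˡ-≤ (2 + 2 * i) (m+n′≤1+n m m≤n) ⟩
    suc n + (2 + 2 * i)     ≡⟨ right n i ⟩
    1 + n + 2 * j           ∎

-- Counting the representatives.

length-layers-suc : (R : ℕ → List (List (Fin k))) → ∀ n m →
  length (layers R n (suc m)) ≡ (suc k * length (R (n ∸ pred m))) ^ suc m + length (layers R n m)
length-layers-suc R n m =
  trans (length-++ (layer R n m)) (cong (_+ length (layers R n m)) (length-layer R n m))

-- A geometric series: layer m has at most M / 2 ^ (m + 1) words, so all layers together leave M / 2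
-- ^ n, which is at least 1, for the universal word.
length-layers-≤ : (R : ℕ → List (List (Fin k))) → ∀ n M → 2 ^ n ≤ M →
  (∀ m → m < n → 2 ^ suc m * (suc k * length (R (n ∸ pred m))) ^ suc m ≤ M) →
  length (layers R n n) ≤ M
length-layers-≤ {k} R n M 2ⁿ≤M bound = *-cancelˡ-≤ (2 ^ n) {{m^n≢0 2 n}} (+-cancelʳ-≤ M _ _ (begin
  2 ^ n * T n + M     ≤⟨ partial n ≤-refl ⟩
  2 ^ n * M + 2 ^ n   ≤⟨ +-monoʳ-≤ (2 ^ n * M) 2ⁿ≤M ⟩
  2 ^ n * M + M       ∎))
  where
  open ≤-Reasoning
  T : ℕ → ℕ
  T j = length (layers R n j)
  t : ℕ → ℕ
  t m = (suc k * length (R (n ∸ pred m))) ^ suc m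
  expand : ∀ p t T M → 2 * p * (t + T) + M + M ≡ 2 * p * t + M + 2 * (p * T) + M
  expand = solve-∀
  regroup : ∀ p T M → M + M + 2 * (p * T) + M ≡ 2 * (p * T + M) + M
  regroup = solve-∀
  collect : ∀ p M → 2 * (p * M + p) + M ≡ 2 * p * M + 2 * p + M
  collect = solve-∀
  -- Divided by 2 ^ j, this reads T j ≤ 1 + M (1 - 2 ^ (-j)).
  partial : ∀ j → j ≤ n → 2 ^ j * T j + M ≤ 2 ^ j * M + 2 ^ j
  partial zero    _   = ≤-reflexive (trans (+-comm 1 M) (cong (_+ 1) (sym (*-identityˡ M))))
  partial (suc j) j<n = +-cancelʳ-≤ M _ _ (begin
    2 ^ suc j * T (suc j) + M + M                    ≡⟨ cong (λ i → 2 ^ suc j * i + M + M) (length-layers-suc R n j) ⟩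
    2 ^ suc j * (t j + T j) + M + M                  ≡⟨ expand (2 ^ j) (t j) (T j) M ⟩
    2 ^ suc j * t j + M + 2 * (2 ^ j * T j) + M      ≤⟨ +-monoˡ-≤ M (+-monoˡ-≤ (2 * (2 ^ j * T j)) (+-monoˡ-≤ M (bound j j<n))) ⟩
    M + M + 2 * (2 ^ j * T j) + M                    ≡⟨ regroup (2 ^ j) (T j) M ⟩
    2 * (2 ^ j * T j + M) + M                        ≤⟨ +-monoˡ-≤ M (*-monoʳ-≤ 2 (partial j (<⇒≤ j<n))) ⟩
    2 * (2 ^ j * M + 2 ^ j) + M                      ≡⟨ collect (2 ^ j) M ⟩
    2 ^ suc j * M + 2 ^ suc j + M                    ∎)

-- The only block over one letter is `(zero , [])`, so each layer is a single word.
length-reps-1 : ∀ n → length (reps 1 n) ≡ suc n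
length-reps-1 n = go n
  where
  go : ∀ m → length (layers (reps 0) n m) ≡ suc m
  go zero    = refl
  go (suc m) = trans (length-layers-suc (reps 0) n m)
                     (cong₂ _+_ (^-zeroˡ (suc m)) (go m))

-- From layer 2 on there are at most 2 n blocks to choose from, and the sum at most doubles where
-- the bound gains a factor 2 n. Layers 0 and 1 have 2 (n + 1) blocks and are checked by expansion
-- in n = 2 + p.
length-reps-2 : ∀ n → 2 ≤ n → length (reps 2 n) ≤ (2 * n) ^ suc n
length-reps-2 n 2≤n with p , refl ← m≤n⇒∃[o]m+o≡n 2≤n = go n
  where
  open ≤-Reasoning
  length-suc : ∀ m → length (layers (reps 1) n (suc m)) ≡
                     (2 * suc (n ∸ pred m)) ^ suc m + length (layers (reps 1) n m)
  length-suc m = trans (length-layers-suc (reps 1) n m)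
    (cong (λ i → (2 * i) ^ suc m + length (layers (reps 1) n m)) (length-reps-1 (n ∸ pred m)))
  expand₁ : ∀ p → 2 * suc (2 + p) * 1 + 1 + (9 + 14 * p + 4 * (p * p)) ≡ 2 * (2 + p) * (2 * (2 + p) * 1)
  expand₁ = solve-∀
  expand₂ : ∀ p → 2 * suc (2 + p) * (2 * suc (2 + p) * 1) + (2 * suc (2 + p) * 1 + 1)
                + (21 + 70 * p + 44 * (p * p) + 8 * (p * p * p))
                ≡ 2 * (2 + p) * (2 * (2 + p) * (2 * (2 + p) * 1))
  expand₂ = solve-∀
  go : ∀ m → length (layers (reps 1) n m) ≤ (2 * n) ^ suc m
  go zero = s≤s z≤n
  go (suc zero) = begin
    length (layers (reps 1) n 1)  ≡⟨ length-suc 0 ⟩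
    2 * suc n * 1 + 1             ≤⟨ m≤m+n _ _ ⟩
    2 * suc n * 1 + 1 + (9 + 14 * p + 4 * (p * p)) ≡⟨ expand₁ p ⟩
    (2 * n) ^ 2                   ∎
  go (suc (suc zero)) = begin
    length (layers (reps 1) n 2)  ≡⟨ length-suc 1 ⟩
    (2 * suc n) ^ 2 + length (layers (reps 1) n 1) ≡⟨ cong ((2 * suc n) ^ 2 +_) (length-suc 0) ⟩
    (2 * suc n) ^ 2 + (2 * suc n * 1 + 1) ≤⟨ m≤m+n _ _ ⟩
    (2 * suc n) ^ 2 + (2 * suc n * 1 + 1) + (21 + 70 * p + 44 * (p * p) + 8 * (p * p * p)) ≡⟨ expand₂ p ⟩
    (2 * n) ^ 3                   ∎
  go (suc m@(suc (suc l))) = begin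
    length (layers (reps 1) n (suc m))                       ≡⟨ length-suc m ⟩
    (2 * suc (n ∸ pred m)) ^ suc m + length (layers (reps 1) n m)
      ≤⟨ +-mono-≤ (^-monoˡ-≤ (suc m) (*-monoʳ-≤ 2 (s≤s (m∸n≤m (suc p) l)))) (go m) ⟩
    (2 * n) ^ suc m + (2 * n) ^ suc m                        ≡⟨ cong ((2 * n) ^ suc m +_) (+-identityʳ _) ⟨
    2 * (2 * n) ^ suc m                                      ≤⟨ *-monoˡ-≤ ((2 * n) ^ suc m) (m≤m*n 2 n) ⟩
    (2 * n) ^ suc (suc m)                                    ∎

-- Per block, the induction step has to absorb the κ choices of a letter and the factor 2 from the
-- geometric series. As 2 κ ≤ κ ^ x, this raises the power of κ in the base by one and gives b ^ x;
-- `exponent-suc` then handles the `suc m` blocks.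
length-reps : ∀ i n → 2 ≤ n → length (reps (2 + i) n) ≤ (n * (2 + i) ^ suc i) ^ exponent i n
length-reps zero n 2≤n = begin
  length (reps 2 n)            ≤⟨ length-reps-2 n 2≤n ⟩
  (2 * n) ^ suc n              ≡⟨ cong (_^ suc n) (*-comm 2 n) ⟩
  (n * 2) ^ suc n              ≤⟨ ^-monoʳ-≤ (n * 2) {{m*n≢0 n 2}} (≤-exponent 0 n {suc n} (≤-reflexive (unit n))) ⟩
  (n * 2) ^ exponent 0 n       ∎
  where
  open ≤-Reasoning
  instance _ = >-nonZero (<⇒≤ 2≤n)
  unit : ∀ n → suc n * 1 ≡ (1 + n + 2 * 0) * 1
  unit = solve-∀
length-reps (suc i) n 2≤n = length-layers-≤ (reps (2 + i)) n (b ^ e) 2ⁿ≤ layer≤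
  where
  open ≤-Reasoning
  κ = 3 + i
  b = n * κ ^ (2 + i)
  e = exponent (suc i) n
  instance
    n≢0 = >-nonZero (<⇒≤ 2≤n)
    b≢0 : NonZero b
    b≢0 = m*n≢0 n (κ ^ (2 + i)) {{n≢0}} {{m^n≢0 κ (2 + i)}}
  -- The level is smallest in the last layer, m = n - 1, where it is still 2, so the induction
  -- hypothesis applies throughout.
  n′≥2 : ∀ m → m < n → 2 ≤ n ∸ pred m
  n′≥2 zero    _   = 2≤n
  n′≥2 (suc m) m<n = m+n≤o⇒m≤o∸n 2 m<n
  n≤e : n ≤ e
  n≤e = begin
    n              ≡⟨ suc-pred n ⟨
    suc l          ≤⟨ m≤m*n (suc l) x {{>-nonZero (<⇒≤ (exponent≥2 i _ (n′≥2 l l<n)))}} ⟩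
    suc l * x      ≤⟨ exponent-suc i n l (<⇒≤ l<n) ⟩
    e              ∎
    where
    l = pred n
    x = exponent i (n ∸ pred l)
    l<n : l < n
    l<n = ≤-reflexive (suc-pred n)
  2ⁿ≤ : 2 ^ n ≤ b ^ e
  2ⁿ≤ = begin
    2 ^ n   ≤⟨ ^-monoˡ-≤ n (≤-trans 2≤n (m≤m*n n (κ ^ (2 + i)) {{m^n≢0 κ (2 + i)}})) ⟩
    b ^ n   ≤⟨ ^-monoʳ-≤ b n≤e ⟩
    b ^ e   ∎
  layer≤ : ∀ m → m < n → 2 ^ suc m * (κ * length (reps (2 + i) (n ∸ pred m))) ^ suc m ≤ b ^ e
  layer≤ m m<n = begin
    2 ^ suc m * (κ * c) ^ suc m      ≡⟨ ^-distribʳ-* 2 (κ * c) (suc m) ⟨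
    (2 * (κ * c)) ^ suc m            ≤⟨ ^-monoˡ-≤ (suc m) block≤ ⟩
    (b ^ x) ^ suc m                  ≡⟨ ^-*-assoc b x (suc m) ⟩
    b ^ (x * suc m)                  ≤⟨ ^-monoʳ-≤ b (subst (_≤ e) (*-comm (suc m) x) (exponent-suc i n m (<⇒≤ m<n))) ⟩
    b ^ e                            ∎
    where
    n′ = n ∸ pred m
    c = length (reps (2 + i) n′)
    x = exponent i n′
    q = κ ^ suc i
    commute : ∀ k y → 2 * (k * y) ≡ k * 2 * y
    commute = solve-∀
    merge : ∀ n k q → k * (n * q) ≡ n * (k * q)
    merge = solve-∀
    block≤ : 2 * (κ * c) ≤ b ^ x
    block≤ = begin
      2 * (κ * c)                     ≡⟨ commute κ c ⟩
      κ * 2 * c                       ≤⟨ *-mono-≤ {κ * 2} {κ ^ 2} (*-monoʳ-≤ κ {2} {κ ^ 1} (s≤s (s≤s z≤n))) (length-reps i n′ (n′≥2 m m<n)) ⟩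
      κ ^ 2 * (n′ * (2 + i) ^ suc i) ^ x ≤⟨ *-mono-≤ (^-monoʳ-≤ κ (exponent≥2 i n′ (n′≥2 m m<n)))
          (^-monoˡ-≤ x (*-mono-≤ (m∸n≤m n (pred m)) (^-monoˡ-≤ (suc i) (n≤1+n (2 + i))))) ⟩
      κ ^ x * (n * q) ^ x             ≡⟨ ^-distribʳ-* κ (n * q) x ⟨
      (κ * (n * q)) ^ x               ≡⟨ cong (_^ x) (merge n κ q) ⟩
      b ^ x                           ∎

-- From integer inequalities to logarithms and cuts.

^-cancelˡ-< : ∀ n {a b} → a ^ n < b ^ n → a < b
^-cancelˡ-< n aⁿ<bⁿ = ≰⇒> (λ b≤a → <⇒≱ aⁿ<bⁿ (^-monoˡ-≤ n b≤a))

^-cancelˡ-≤ : ∀ n .{{_ : NonZero n}} {a b} → a ^ n ≤ b ^ n → a ≤ b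
^-cancelˡ-≤ n aⁿ≤bⁿ = ≮⇒≥ (λ b<a → ≤⇒≯ aⁿ≤bⁿ (^-monoˡ-< n b<a))

2^-cancel-< : ∀ {m n} → 2 ^ m < 2 ^ n → m < n
2^-cancel-< 2ᵐ<2ⁿ = ≰⇒> (λ n≤m → <⇒≱ 2ᵐ<2ⁿ (^-monoʳ-≤ 2 n≤m))

^-comm : ∀ a m n → (a ^ m) ^ n ≡ (a ^ n) ^ m
^-comm a m n = trans (^-*-assoc a m n) (trans (cong (a ^_) (*-comm m n)) (sym (^-*-assoc a n m)))

n≤2^n : ∀ n → n ≤ 2 ^ n
n≤2^n zero    = z≤n
n≤2^n (suc n) = subst (suc n ≤_) (cong (2 ^ n +_) (sym (+-identityʳ (2 ^ n))))
                  (+-mono-≤ (m^n>0 2 n) (n≤2^n n))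

num-* : ∀ p q {a b} → ↥ p ≡ pos a → ↥ q ≡ pos b → ↥ (p ℚ.* q) ≡ pos (a * b)
num-* (mkℚᵘ _ _) (mkℚᵘ _ _) {a} {b} refl refl = sym (pos-* a b)

den-* : ∀ p q → ↧ₙ (p ℚ.* q) ≡ ↧ₙ p * ↧ₙ q
den-* (mkℚᵘ _ _) (mkℚᵘ _ _) = refl

num-^ : ∀ q {a} n → ↥ q ≡ pos a → ↥ (q ^ℚ n) ≡ pos (a ^ n)
num-^ q zero    eq = refl
num-^ q (suc n) eq = num-* q (q ^ℚ n) eq (num-^ q n eq)

den-^ : ∀ q n → ↧ₙ (q ^ℚ n) ≡ ↧ₙ q ^ n
den-^ q zero    = refl
den-^ q (suc n) = trans (den-* q (q ^ℚ n)) (cong (↧ₙ q *_) (den-^ q n))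

<-cross : ∀ {p q a} → p ℚ.< q → ↥ p ≡ pos a → a * ↧ₙ q < ∣ ↥ q ∣ * ↧ₙ p
<-cross {mkℚᵘ _ d} {mkℚᵘ (pos b) f} {a} (*<* lt) refl =
  ℤ.drop‿+<+ (subst₂ ℤ._<_ (sym (pos-* a (suc f))) (sym (pos-* b (suc d))) lt)
<-cross {mkℚᵘ _ d} {mkℚᵘ -[1+ b ] f} {a} (*<* lt) refl
  with subst (ℤ._< -[1+ b ] ℤ.* pos (suc d)) (sym (pos-* a (suc f))) lt
... | ()

≤-cross : ∀ {p q a} → p ℚ.≤ q → ↥ p ≡ pos a → a * ↧ₙ q ≤ ∣ ↥ q ∣ * ↧ₙ p
≤-cross {mkℚᵘ _ d} {mkℚᵘ (pos b) f} {a} (*≤* le) refl =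
  ℤ.drop‿+≤+ (subst₂ ℤ._≤_ (sym (pos-* a (suc f))) (sym (pos-* b (suc d))) le)
≤-cross {mkℚᵘ _ d} {mkℚᵘ -[1+ b ] f} {a} (*≤* le) refl
  with subst (ℤ._≤ -[1+ b ] ℤ.* pos (suc d)) (sym (pos-* a (suc f))) le
... | ()

cross-≤ : ∀ {p q a b} → ↥ p ≡ pos a → ↥ q ≡ pos b → a * ↧ₙ q ≤ b * ↧ₙ p → p ℚ.≤ q
cross-≤ {mkℚᵘ _ d} {mkℚᵘ _ f} {a} {b} refl refl le =
  *≤* (subst₂ ℤ._≤_ (pos-* a (suc f)) (pos-* b (suc d)) (+≤+ le))

cross-< : ∀ {p q a b} → ↥ p ≡ pos a → ↥ q ≡ pos b → a * ↧ₙ q < b * ↧ₙ p → p ℚ.< q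
cross-< {mkℚᵘ _ d} {mkℚᵘ _ f} {a} {b} refl refl lt =
  *<* (subst₂ ℤ._<_ (pos-* a (suc f)) (pos-* b (suc d)) (+<+ lt))

Positive⇒↥≡ : ∀ q → Positive q → ↥ q ≡ pos ∣ ↥ q ∣
Positive⇒↥≡ (mkℚᵘ (pos _) _) _ = refl

-- The hypothesis `bound` says log S ≤ E b for all rationals b above `X`. A rational r above the
-- right side comes with some a > E b such that 2 ^ a ≤ r, whence S < r. Fractional powers are
-- avoided by raising to the denominators.
≤ᶜ-2^ : ∀ {S E e X} → pos E ℚ./ 1 ℚ.≤ e →
        (∀ b → X b → Positive b × S ^ ↧ₙ b ≤ 2 ^ (E * ∣ ↥ b ∣)) →
        fromℕ S ≤ᶜ 2^ (fromℚ e · X)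
≤ᶜ-2^ {S} {E} {e} {X} E≤e bound {r} (r>0 , a , (a₁ , b , e<a₁ , Xb , a₁b≤a) , 2ᵃ≤r)
  with b>0 , Sᵈ≤ ← bound b Xb =
  cross-< {pos S ℚ./ 1} {r} refl (Positive⇒↥≡ r r>0) (subst (S * v <_) (sym (*-identityʳ u)) S*v<u)
  where
  open ≤-Reasoning
  x = ∣ ↥ b ∣
  d = ↧ₙ b
  y = ∣ ↥ a ∣
  f = ↧ₙ a
  u = ∣ ↥ r ∣
  v = ↧ₙ r
  Eb = (pos E ℚ./ 1) ℚ.* b
  -- The strictness stems from `e<a₁`: members of the cut of `e` lie strictly above `e`.
  Eb<a : Eb ℚ.< a
  Eb<a = ℚ.<-≤-trans (ℚ.*-monoˡ-<-pos b {{b>0}} (ℚ.≤-<-trans E≤e e<a₁)) a₁b≤a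
  Exf<yd : E * x * f < y * d
  Exf<yd = subst (λ i → E * x * f < y * i) (trans (den-* (pos E ℚ./ 1) b) (*-identityˡ d))
    (<-cross Eb<a (num-* (pos E ℚ./ 1) b refl (Positive⇒↥≡ b b>0)))
  Sᶠ<2ʸ : S ^ f < 2 ^ y
  Sᶠ<2ʸ = ^-cancelˡ-< d (begin-strict
    (S ^ f) ^ d         ≡⟨ ^-comm S f d ⟩
    (S ^ d) ^ f         ≤⟨ ^-monoˡ-≤ f Sᵈ≤ ⟩
    (2 ^ (E * x)) ^ f   ≡⟨ ^-*-assoc 2 (E * x) f ⟩
    2 ^ (E * x * f)     <⟨ ^-monoʳ-< 2 (s≤s (s≤s z≤n)) Exf<yd ⟩
    2 ^ (y * d)         ≡⟨ ^-*-assoc 2 y d ⟨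
    (2 ^ y) ^ d         ∎)
  2ʸvᶠ≤uᶠ : 2 ^ y * v ^ f ≤ u ^ f
  2ʸvᶠ≤uᶠ = subst₂ _≤_ (cong (2 ^ y *_) (den-^ r f))
    (trans (cong₂ _*_ (cong ∣_∣ (num-^ r f (Positive⇒↥≡ r r>0))) (trans (den-^ (pos 2 ℚ./ 1) y) (^-zeroˡ y)))
           (*-identityʳ (u ^ f)))
    (≤-cross 2ᵃ≤r (num-^ (pos 2 ℚ./ 1) y refl))
  S*v<u : S * v < u
  S*v<u = ^-cancelˡ-< f (begin-strict
    (S * v) ^ f      ≡⟨ ^-distribʳ-* S v f ⟩
    S ^ f * v ^ f    <⟨ *-monoˡ-< (v ^ f) {{m^n≢0 v f}} Sᶠ<2ʸ ⟩
    2 ^ y * v ^ f    ≤⟨ 2ʸvᶠ≤uᶠ ⟩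
    u ^ f            ∎)

log₂-bound : ∀ {n S E} → S ≤ n ^ E → ∀ b → log₂ n b → Positive b × S ^ ↧ₙ b ≤ 2 ^ (E * ∣ ↥ b ∣)
log₂-bound {n} {S} {E} S≤ b (b>0 , nᵈ<2ˣ) = b>0 , (begin
  S ^ d         ≤⟨ ^-monoˡ-≤ d S≤ ⟩
  (n ^ E) ^ d   ≡⟨ ^-comm n E d ⟩
  (n ^ d) ^ E   ≤⟨ ^-monoˡ-≤ E (<⇒≤ nᵈ<2ˣ) ⟩
  (2 ^ x) ^ E   ≡⟨ ^-*-assoc 2 x E ⟩
  2 ^ (x * E)   ≡⟨ cong (2 ^_) (*-comm x E) ⟩
  2 ^ (E * x)   ∎)
  where
  open ≤-Reasoning
  d = ↧ₙ b
  x = ∣ ↥ b ∣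

pos-≤⇒Positive : ∀ {p q} → Positive p → p ℚ.≤ q → Positive q
pos-≤⇒Positive {p} p>0 p≤q = ℚ.positive (ℚ.<-≤-trans (ℚ.positive⁻¹ p {{p>0}}) p≤q)

-- Both logarithms are at least 1, hence log n and log k are at most
-- log n · log k.
log₂·log₂-bound : ∀ {n j S g} → 2 ≤ n → 1 ≤ j → S ≤ (n * suc j ^ j) ^ g →
  ∀ b → (log₂ n · log₂ (suc j)) b → Positive b × S ^ ↧ₙ b ≤ 2 ^ (suc j * g * ∣ ↥ b ∣)
log₂·log₂-bound {n} {j} {S} {g} 2≤n 1≤j S≤ b (c₁ , c₂ , (c₁>0 , nᵍ<2ᵖ) , (c₂>0 , kᵗ<2ˢ) , c₁c₂≤b) =
  pos-≤⇒Positive (ℚ.pos*pos⇒pos c₁ {{c₁>0}} c₂ {{c₂>0}}) c₁c₂≤b ,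
  -- The exponent `q * t` clears the denominators of both logarithms.
  ^-cancelˡ-≤ (q * t) {{m*n≢0 q t}} (begin
    (S ^ d) ^ (q * t)                        ≤⟨ ^-monoˡ-≤ (q * t) (^-monoˡ-≤ d S≤) ⟩
    (((n * κ ^ j) ^ g) ^ d) ^ (q * t)        ≡⟨ cong (_^ (q * t)) (^-*-assoc (n * κ ^ j) g d) ⟩
    ((n * κ ^ j) ^ (g * d)) ^ (q * t)        ≡⟨ ^-*-assoc (n * κ ^ j) (g * d) (q * t) ⟩
    (n * κ ^ j) ^ e                          ≡⟨ ^-distribʳ-* n (κ ^ j) e ⟩
    n ^ e * (κ ^ j) ^ e                      ≤⟨ *-mono-≤ n^≤ κ^≤ ⟩
    -- One share from `n` and `j` shares from `κ ^ j` make up the factor k of the coefficient.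
    2 ^ (g * w) * 2 ^ (j * (g * w))          ≡⟨ ^-distribˡ-+-* 2 (g * w) (j * (g * w)) ⟨
    2 ^ (κ * (g * w))                        ≤⟨ ^-monoʳ-≤ 2 (*-monoʳ-≤ κ (*-monoʳ-≤ g w≤)) ⟩
    2 ^ (κ * (g * (x * (q * t))))            ≡⟨ cong (2 ^_) (assoc κ g x (q * t)) ⟩
    2 ^ (κ * g * x * (q * t))                ≡⟨ ^-*-assoc 2 (κ * g * x) (q * t) ⟨
    (2 ^ (κ * g * x)) ^ (q * t)              ∎)
  where
  open ≤-Reasoning
  κ = suc j
  d = ↧ₙ b
  x = ∣ ↥ b ∣
  p = ∣ ↥ c₁ ∣
  q = ↧ₙ c₁
  s = ∣ ↥ c₂ ∣
  t = ↧ₙ c₂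
  w = p * s * d
  e = g * d * (q * t)
  assoc : ∀ k g x y → k * (g * (x * y)) ≡ k * g * x * y
  assoc = solve-∀
  w≤ : w ≤ x * (q * t)
  w≤ = subst (λ i → w ≤ x * i) (den-* c₁ c₂)
    (≤-cross c₁c₂≤b (num-* c₁ c₂ (Positive⇒↥≡ c₁ c₁>0) (Positive⇒↥≡ c₂ c₂>0)))
  log≥1 : ∀ {a m l} → 2 ≤ a → a ^ m < 2 ^ l → m ≤ l
  log≥1 {m = m} 2≤a a^m< = <⇒≤ (2^-cancel-< (≤-<-trans (^-monoˡ-≤ m 2≤a) a^m<))
  q≤p : q ≤ p
  q≤p = log≥1 2≤n nᵍ<2ᵖ
  t≤s : t ≤ s
  t≤s = log≥1 (s≤s 1≤j) kᵗ<2ˢ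
  n^≤ : n ^ e ≤ 2 ^ (g * w)
  n^≤ = begin
    n ^ e                      ≡⟨ cong (n ^_) (split g d q t) ⟩
    n ^ (q * (g * (d * t)))    ≡⟨ ^-*-assoc n q (g * (d * t)) ⟨
    (n ^ q) ^ (g * (d * t))    ≤⟨ ^-monoˡ-≤ (g * (d * t)) (<⇒≤ nᵍ<2ᵖ) ⟩
    (2 ^ p) ^ (g * (d * t))    ≤⟨ ^-monoʳ-≤ (2 ^ p) {{m^n≢0 2 p}} (*-monoʳ-≤ g (*-monoʳ-≤ d t≤s)) ⟩
    (2 ^ p) ^ (g * (d * s))    ≡⟨ ^-*-assoc 2 p _ ⟩
    2 ^ (p * (g * (d * s)))    ≡⟨ cong (2 ^_) (merge p g d s) ⟩
    2 ^ (g * w)                ∎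
    where
    split : ∀ g d q t → g * d * (q * t) ≡ q * (g * (d * t))
    split = solve-∀
    merge : ∀ p g d s → p * (g * (d * s)) ≡ g * (p * s * d)
    merge = solve-∀
  κ^≤ : (κ ^ j) ^ e ≤ 2 ^ (j * (g * w))
  κ^≤ = begin
    (κ ^ j) ^ e                    ≡⟨ ^-*-assoc κ j e ⟩
    κ ^ (j * e)                    ≡⟨ cong (κ ^_) (split j g d q t) ⟩
    κ ^ (t * (j * (g * (d * q))))  ≡⟨ ^-*-assoc κ t (j * (g * (d * q))) ⟨
    (κ ^ t) ^ (j * (g * (d * q)))  ≤⟨ ^-monoˡ-≤ (j * (g * (d * q))) (<⇒≤ kᵗ<2ˢ) ⟩
    (2 ^ s) ^ (j * (g * (d * q)))  ≤⟨ ^-monoʳ-≤ (2 ^ s) {{m^n≢0 2 s}} (*-monoʳ-≤ j (*-monoʳ-≤ g (*-monoʳ-≤ d q≤p))) ⟩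
    (2 ^ s) ^ (j * (g * (d * p)))  ≡⟨ ^-*-assoc 2 s _ ⟩
    2 ^ (s * (j * (g * (d * p))))  ≡⟨ cong (2 ^_) (merge p j g d s) ⟩
    2 ^ (j * (g * w))              ∎
    where
    split : ∀ j g d q t → j * (g * d * (q * t)) ≡ t * (j * (g * (d * q)))
    split = solve-∀
    merge : ∀ p j g d s → s * (j * (g * (d * p))) ≡ j * (g * (p * s * d))
    merge = solve-∀

exponent-≤-coefficient : ∀ i (k>1 : 2 + i > 1) n →
  pos ((2 + i) * exponent i n) ℚ./ 1 ℚ.≤ coefficient (2 + i) k>1 n
exponent-≤-coefficient i k>1 n = cross-≤ {pos (κ * g) ℚ./ 1} {coefficient κ k>1 n} refl
  (num-* (pos κ ℚ./ 1) (ratio ^ℚ suc i) refl (num-^ ratio (suc i) (cong pos numerator))) (begin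
    κ * g * ↧ₙ (coefficient κ k>1 n)      ≡⟨ cong (κ * g *_) denominator ⟩
    κ * g * suc i ^ suc i                 ≡⟨ *-assoc κ g _ ⟩
    κ * (g * suc i ^ suc i)               ≤⟨ *-monoʳ-≤ κ (exponent-≤ i n) ⟩
    κ * (1 + n + 2 * i) ^ suc i           ≡⟨ *-identityʳ _ ⟨
    κ * (1 + n + 2 * i) ^ suc i * 1       ∎)
  where
  open ≤-Reasoning
  κ = 2 + i
  g = exponent i n
  ratio = mkℚᵘ (pos (n + 2 * κ ∸ 3)) i
  shift : ∀ n i → n + 2 * (2 + i) ≡ 3 + (1 + n + 2 * i)
  shift = solve-∀
  numerator : n + 2 * κ ∸ 3 ≡ 1 + n + 2 * i
  numerator = cong (_∸ 3) (shift n i)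
  denominator : ↧ₙ (coefficient κ k>1 n) ≡ suc i ^ suc i
  denominator = trans (den-* (pos κ ℚ./ 1) (ratio ^ℚ suc i))
                      (trans (*-identityˡ _) (den-^ ratio (suc i)))

-- The constant of the O-notation comes from k ≤ 2 ^ k ≤ n ^ k and
-- n + 2k - 3 ≤ 2 (k - 1) n.
polynomial-bound : ∀ i n → 2 ≤ n → (n * (2 + i) ^ suc i) ^ exponent i n ≤
  n ^ ((1 + (2 + i) * suc i) * (2 + 2 * i) ^ suc i * n ^ suc i)
polynomial-bound i n 2≤n = begin
  (n * κ ^ j) ^ g                        ≤⟨ ^-monoˡ-≤ g (*-monoʳ-≤ n (^-monoˡ-≤ j (≤-trans (n≤2^n κ) (^-monoˡ-≤ κ 2≤n)))) ⟩
  (n * (n ^ κ) ^ j) ^ g                  ≡⟨ cong (λ y → (n * y) ^ g) (^-*-assoc n κ j) ⟩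
  (n ^ (1 + κ * j)) ^ g                  ≡⟨ ^-*-assoc n (1 + κ * j) g ⟩
  n ^ ((1 + κ * j) * g)                  ≤⟨ ^-monoʳ-≤ n (*-monoʳ-≤ (1 + κ * j) g≤) ⟩
  n ^ ((1 + κ * j) * (l ^ j * n ^ j))    ≡⟨ cong (n ^_) (*-assoc (1 + κ * j) (l ^ j) (n ^ j)) ⟨
  n ^ ((1 + κ * j) * l ^ j * n ^ j)      ∎
  where
  open ≤-Reasoning
  instance _ = >-nonZero (<⇒≤ 2≤n)
  κ = 2 + i
  j = suc i
  g = exponent i n
  l = 2 + 2 * i
  base≤ : 1 + n + 2 * i ≤ l * n
  base≤ = begin
    1 + n + 2 * i          ≡⟨ cong (_+ 2 * i) (+-comm 1 n) ⟩
    n + 1 + 2 * i          ≡⟨ +-assoc n 1 (2 * i) ⟩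
    n + (1 + 2 * i)        ≤⟨ +-monoʳ-≤ n (m≤m*n (1 + 2 * i) n) ⟩
    l * n                  ∎
  g≤ : g ≤ l ^ j * n ^ j
  g≤ = begin
    g                      ≤⟨ m≤m*n g (j ^ j) {{m^n≢0 j j}} ⟩
    g * j ^ j              ≤⟨ exponent-≤ i n ⟩
    (1 + n + 2 * i) ^ j    ≤⟨ ^-monoˡ-≤ j base≤ ⟩
    (l * n) ^ j            ≡⟨ ^-distribʳ-* l n j ⟩
    l ^ j * n ^ j          ∎

theorem2 : (k : ℕ) (k>1 : k > 1) →
    ((A : Set) → A ↔ Fin k → (L : Language A) → Decidable L →
    (n : ℕ) → n > 1 → IsPT n L →
    ∃[ D ] (IsMinimalDFA D L ×
    fromℕ (size D) ≤ᶜ 2^ (fromℚ (coefficient k k>1 n) · log₂ n · log₂ k)))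
    ×
    (∃[ c ] ∃[ n₀ ] ((A : Set) → A ↔ Fin k → (L : Language A) → Decidable L →
    (n : ℕ) → n ≥ n₀ → HasHeight L n →
    ∃[ D ] (IsMinimalDFA D L ×
    fromℕ (size D) ≤ᶜ 2^ (fromℕ (c * n ^ (k ∸ 1)) · log₂ n))))
theorem2 1               (s≤s ())
-- The threshold is 2, where `length-reps` starts to apply; `c` is the constant in
-- `polynomial-bound`.
theorem2 k@(suc (suc i)) k>1 = explicit , c , 2 , asymptotic
  where
  c = (1 + k * suc i) * (2 + 2 * i) ^ suc i
  explicit : (A : Set) → A ↔ Fin k → (L : Language A) → Decidable L →
    (n : ℕ) → n > 1 → IsPT n L →
    ∃[ D ] (IsMinimalDFA D L ×
      fromℕ (size D) ≤ᶜ 2^ (fromℚ (coefficient k k>1 n) · log₂ n · log₂ k))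
  explicit A A↔Fin L L? n n>1 pt = map₂ (map₂ λ size≤ →
    ≤ᶜ-2^ (exponent-≤-coefficient i k>1 n)
      (log₂·log₂-bound {g = exponent i n} n>1 (s≤s z≤n) (≤-trans size≤ (length-reps i n n>1))))
    (minimalDFA A↔Fin L L? pt)
  asymptotic : (A : Set) → A ↔ Fin k → (L : Language A) → Decidable L →
    (n : ℕ) → n ≥ 2 → HasHeight L n →
    ∃[ D ] (IsMinimalDFA D L × fromℕ (size D) ≤ᶜ 2^ (fromℕ (c * n ^ suc i) · log₂ n))
  asymptotic A A↔Fin L L? n n≥2 (pt , _) = map₂ (map₂ λ size≤ →
    ≤ᶜ-2^ ℚ.≤-refl (log₂-bound {E = c * n ^ suc i}
      (≤-trans size≤ (≤-trans (length-reps i n n≥2) (polynomial-bound i n n≥2)))))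
    (minimalDFA A↔Fin L L? pt)
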